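{- We have $h(\alpha) \geq 5$ for every real $\alpha \geq 2$ and $h(\alpha) \geq 7$ for every $\alpha \in \left[\frac{1+\sqrt{5}}{2},2\right)$. For every $\alpha \in \left(1,\frac{1+\sqrt{5}}{2}\right)$, we have \[h(\alpha) \geq \left\lfloor\sqrt{\frac{1}{\alpha - 1}}\right\rfloor.\]
   Context: $\mathbb{N}_0=\{0,1,2,\dots\}$. For a real number $\alpha>1$, the exponential lattice is $L(\alpha)=\{\alpha^n \colon n \in \mathbb{N}_0\}^2=\{(\alpha^i,\alpha^j)\colon i,j\in\mathbb{N}_0\}\subseteq\mathbb{R}^2$. For a discrete set $S\subseteq\mathbb{R}^2$, a convex polygon $P$ with all vertices in $S$ is empty in $S$ if $P$ (including its boundary, in particular the interiors of its edges) contains no points of $S$ other than its vertices. $h(S)$ denotes the maximum number of vertices of an empty polygon in $S$, with $h(S)=\infty$ if there are empty polygons in $S$ with arbitrarily many vertices. $h(\alpha)$ abbreviates $h(L(\alpha))$. -}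

module Defs where

open import Algebra.Bundles using (CommutativeRing; Semiring)
open import Data.Empty using (⊥-elim)
open import Data.Nat.Base as ℕ using (ℕ; zero; suc)
import Data.Nat.Properties as ℕ
open import Data.Product.Base using (_×_; _,_; ∃-syntax; Σ-syntax; proj₁; proj₂)
open import Data.Sum.Base using (inj₁; inj₂)
open import Data.Unit.Base using (⊤; tt)
open import Data.Vec.Functional using (Vector)
open import Function.Bundles using (_⇔_; mk⇔)
open import Level using (0ℓ)
open import Relation.Binary.Core using (Rel)
open import Relation.Binary.Bundles using (StrictTotalOrder; DecTotalOrder)
open import Relation.Binary.Definitions using (tri<; tri≈; tri>)
open import Relation.Binary.PropositionalEquality.Core using (_≢_)
open import Relation.Binary.Structures using (IsStrictTotalOrder)
open import Relation.Nullary using (¬_; yes; no)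
open import Relation.Unary using (Pred; _∈_; Satisfiable)
import Algebra.Definitions.RawMonoid as RawMonoidDefs
import Algebra.Definitions.RawSemiring as RawSemiringDefs
import Algebra.Solver.Ring.NaturalCoefficients.Default as NatSolver
import Relation.Binary.Construct.StrictToNonStrict as StrictToNonStrict
import Relation.Binary.Properties.StrictTotalOrder as StrictTotalOrderProps

-- The classical real numbers, characterised up to isomorphism as a
-- Dedekind-complete ordered field.  The Archimedean property follows from
-- completeness only up to double negation, so it is listed separately in order
-- to have a witness.  Equality is a setoid equality so that quotient-free
-- constructions (Cauchy sequences of rationals, say) qualify as models.

record RealField : Set₁ where
  infix  4 _<_
  infix  8 _⁻¹
  field
    commutativeRing : CommutativeRing 0ℓ 0ℓ

  open CommutativeRing commutativeRing public renaming (Carrier to ℝ)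
  open RawMonoidDefs +-rawMonoid public using (sum) renaming (_×_ to _·_)
  open RawSemiringDefs (Semiring.rawSemiring semiring) public using (_^_)

  fromℕ : ℕ → ℝ
  fromℕ n = n · 1#

  field
    _<_                : Rel ℝ 0ℓ
    isStrictTotalOrder : IsStrictTotalOrder _≈_ _<_
    1≉0                : ¬ (1# ≈ 0#)
    -- Total for convenience; 0# ⁻¹ is unspecified.
    _⁻¹                : ℝ → ℝ
    ⁻¹-inverseʳ        : ∀ {x} → ¬ (x ≈ 0#) → x * x ⁻¹ ≈ 1#
    +-monoʳ-<          : ∀ z {x y} → x < y → z + x < z + y
    *-pos              : ∀ {x y} → 0# < x → 0# < y → 0# < x * y
    archimedean        : ∀ x → ∃[ n ] x < fromℕ n

  open StrictToNonStrict _≈_ _<_ public using (_≤_)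

  UpperBound : Pred ℝ 0ℓ → Pred ℝ 0ℓ
  UpperBound A b = ∀ {x} → x ∈ A → x ≤ b

  IsSupremum : Pred ℝ 0ℓ → Pred ℝ 0ℓ
  IsSupremum A s = UpperBound A s × (∀ {b} → UpperBound A b → s ≤ b)

  field
    completeness : (A : Pred ℝ 0ℓ) → Satisfiable A → Satisfiable (UpperBound A) →
                   ∃[ s ] IsSupremum A s

module RealFieldProperties (𝓡 : RealField) where
  open RealField 𝓡 hiding (zero)
  open NatSolver commutativeSemiring using (solve; _:=_; _:+_; _:*_; con)

  strictTotalOrder : StrictTotalOrder 0ℓ 0ℓ 0ℓ
  strictTotalOrder = record { isStrictTotalOrder = isStrictTotalOrder }

  open StrictTotalOrder strictTotalOrder public
    using (compare; irrefl; <-resp-≈) renaming (trans to <-trans)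
  open DecTotalOrder (StrictTotalOrderProps.decTotalOrder strictTotalOrder) public
    using (_≤?_) renaming (antisym to ≤-antisym; trans to ≤-trans)

  <-respʳ-≈ : ∀ {x y z} → y ≈ z → x < y → x < z
  <-respʳ-≈ = proj₁ <-resp-≈

  <-respˡ-≈ : ∀ {x y z} → y ≈ z → y < x → z < x
  <-respˡ-≈ = proj₂ <-resp-≈

  <-≤-trans : ∀ {x y z} → x < y → y ≤ z → x < z
  <-≤-trans = StrictToNonStrict.<-≤-trans _≈_ _<_ <-trans <-respʳ-≈

  ≤-<-trans : ∀ {x y z} → x ≤ y → y < z → x < z
  ≤-<-trans = StrictToNonStrict.≤-<-trans _≈_ _<_ sym <-trans <-respˡ-≈

  <⇒≱ : ∀ {x y} → x < y → ¬ (y ≤ x)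
  <⇒≱ x<y y≤x = irrefl refl (<-≤-trans x<y y≤x)

  ≰⇒> : ∀ {x y} → ¬ (x ≤ y) → y < x
  ≰⇒> {x} {y} x≰y with compare x y
  ... | tri< x<y _ _ = ⊥-elim (x≰y (inj₁ x<y))
  ... | tri≈ _ x≈y _ = ⊥-elim (x≰y (inj₂ x≈y))
  ... | tri> _ _ y<x = y<x

  ≮⇒≥ : ∀ {x y} → ¬ (x < y) → y ≤ x
  ≮⇒≥ {x} {y} x≮y with compare x y
  ... | tri< x<y _ _ = ⊥-elim (x≮y x<y)
  ... | tri≈ _ x≈y _ = inj₂ (sym x≈y)
  ... | tri> _ _ y<x = inj₁ y<x

  <⇒∃ : ∀ {x y} → x < y → ∃[ d ] (0# < d × y ≈ x + d)
  <⇒∃ {x} {y} x<y =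
    (- x + y) ,
    <-respˡ-≈ (-‿inverseˡ x) (+-monoʳ-< (- x) x<y) ,
    trans (sym (+-identityˡ y))
      (trans (+-congʳ (sym (-‿inverseʳ x))) (+-assoc x (- x) y))

  x<x+d : ∀ {x y d} → 0# < d → y ≈ x + d → x < y
  x<x+d {x} 0<d y≈ = <-respʳ-≈ (sym y≈) (<-respˡ-≈ (+-identityʳ x) (+-monoʳ-< x 0<d))

  +-pos : ∀ {x y} → 0# < x → 0# ≤ y → 0# < x + y
  +-pos 0<x (inj₁ 0<y) = <-trans 0<x (x<x+d 0<y refl)
  +-pos 0<x (inj₂ 0≈y) = <-respʳ-≈ (trans (sym (+-identityʳ _)) (+-congˡ 0≈y)) 0<x

  +-nonneg : ∀ {x y} → 0# ≤ x → 0# ≤ y → 0# ≤ x + y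
  +-nonneg (inj₁ 0<x) 0≤y = inj₁ (+-pos 0<x 0≤y)
  +-nonneg (inj₂ 0≈x) 0≤y = ≤-trans 0≤y (inj₂ (trans (sym (+-identityˡ _)) (+-congʳ 0≈x)))

  *-nonneg : ∀ {x y} → 0# ≤ x → 0# ≤ y → 0# ≤ x * y
  *-nonneg (inj₁ 0<x) (inj₁ 0<y) = inj₁ (*-pos 0<x 0<y)
  *-nonneg (inj₁ 0<x) (inj₂ 0≈y) = inj₂ (trans (sym (zeroʳ _)) (*-congˡ 0≈y))
  *-nonneg (inj₂ 0≈x) _          = inj₂ (trans (sym (zeroˡ _)) (*-congʳ 0≈x))

  +-cancelˡ-< : ∀ z {x y} → z + x < z + y → x < y
  +-cancelˡ-< z {x} {y} lt = <-respˡ-≈ (cancel x) (<-respʳ-≈ (cancel y) (+-monoʳ-< (- z) lt))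
    where
    cancel : ∀ w → - z + (z + w) ≈ w
    cancel w = trans (sym (+-assoc (- z) z w))
                 (trans (+-congʳ (-‿inverseˡ z)) (+-identityˡ w))

  *-monoʳ-< : ∀ {z x y} → 0# < z → x < y → z * x < z * y
  *-monoʳ-< {z} {x} 0<z x<y =
    let d , 0<d , y≈x+d = <⇒∃ x<y
    in x<x+d (*-pos 0<z 0<d) (trans (*-congˡ y≈x+d) (distribˡ z x d))

  square-< : ∀ {x y} → 0# ≤ x → x < y → x * x < y * y
  square-< {x} {y} (inj₂ 0≈x) x<y =
    <-respˡ-≈ (trans (sym (zeroˡ x)) (*-congʳ 0≈x)) (*-pos 0<y 0<y)
    where 0<y = <-respˡ-≈ (sym 0≈x) x<y
  square-< {x} {y} (inj₁ 0<x) x<y =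
    <-trans (*-monoʳ-< 0<x x<y)
      (<-respˡ-≈ (*-comm y x) (*-monoʳ-< (<-trans 0<x x<y) x<y))

  square-cancel-< : ∀ {x y} → 0# ≤ y → x * x < y * y → x < y
  square-cancel-< {x} {y} 0≤y lt with compare x y
  ... | tri< x<y _ _ = x<y
  ... | tri≈ _ x≈y _ = ⊥-elim (irrefl (*-cong x≈y x≈y) lt)
  ... | tri> _ _ y<x = ⊥-elim (irrefl refl (<-trans lt (square-< 0≤y y<x)))

  *-cancelʳ-< : ∀ {z x y} → 0# < z → x * z < y * z → x < y
  *-cancelʳ-< {z} {x} {y} 0<z lt with compare x y
  ... | tri< x<y _ _ = x<y
  ... | tri≈ _ x≈y _ = ⊥-elim (irrefl (*-congʳ x≈y) lt)
  ... | tri> _ _ y<x = ⊥-elim (irrefl refl (<-trans lt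
          (<-respˡ-≈ (*-comm z y) (<-respʳ-≈ (*-comm z x) (*-monoʳ-< 0<z y<x)))))

  rearrange-< : ∀ {p q r s} → p < q → r < s → p * s + q * r < p * r + q * s
  rearrange-< {p} {q} {r} {s} p<q r<s =
    let d , 0<d , q≈ = <⇒∃ p<q
        e , 0<e , s≈ = <⇒∃ r<s
    in x<x+d (*-pos 0<d 0<e)
         (trans (+-congˡ (*-cong q≈ s≈))
           (trans
             (solve 4 (λ p r d e →
                p :* r :+ (p :+ d) :* (r :+ e) :=
                (p :* (r :+ e) :+ (p :+ d) :* r) :+ d :* e) refl p r d e)
             (+-congʳ (+-cong (*-congˡ (sym s≈)) (*-congʳ (sym q≈))))))

  0<1 : 0# < 1#
  0<1 with compare 0# 1#
  ... | tri< 0<1 _ _ = 0<1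
  ... | tri≈ _ 0≈1 _ = ⊥-elim (1≉0 (sym 0≈1))
  ... | tri> _ _ 1<0 =
    let d , 0<d , 0≈1+d = <⇒∃ 1<0
    in <-respʳ-≈ (trans (sym (+-identityʳ (d * d)))
         (trans (+-congˡ (trans (sym (zeroˡ (1# + d))) (*-congʳ 0≈1+d)))
         (trans (solve 1 (λ d → d :* d :+ (con 1 :+ d) :* (con 1 :+ d) :=
                   con 1 :+ ((con 1 :+ d) :* d :+ (con 1 :+ d) :* d)) refl d)
         (trans (+-congˡ (+-cong (*-congʳ (sym 0≈1+d)) (*-congʳ (sym 0≈1+d))))
           (trans (+-congˡ (trans (+-congʳ (zeroˡ d)) (trans (+-identityˡ _) (zeroˡ d))))
             (+-identityʳ 1#))))))
         (*-pos 0<d 0<d)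

  inverse-pos : ∀ {x} → 0# < x → 0# < x ⁻¹
  inverse-pos {x} 0<x = *-cancelʳ-< 0<x
    (<-respˡ-≈ (sym (zeroˡ x))
      (<-respʳ-≈ (trans (sym (⁻¹-inverseʳ (λ x≈0 → irrefl (sym x≈0) 0<x))) (*-comm x (x ⁻¹)))
        0<1))

  -- √ is defined by completeness on 0# ≤ x and has the value 0# elsewhere.

  private
    module Root {x : ℝ} (0≤x : 0# ≤ x) where
      a : ℝ
      a = 1# + x

      0<a : 0# < a
      0<a = +-pos 0<1 0≤x

      x<a² : x < a * a
      x<a² = <-≤-trans (<-respʳ-≈ (+-comm x 1#) (x<x+d 0<1 refl)) (a≤a² 0≤x)
        where
        a≤a² : 0# ≤ x → a ≤ a * a
        a≤a² (inj₂ 0≈x) = inj₂ (trans (sym (*-identityʳ a))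
          (*-congˡ (trans (sym (+-identityʳ 1#)) (+-congˡ 0≈x))))
        a≤a² (inj₁ 0<x) = inj₁ (x<x+d (*-pos 0<a 0<x)
          (trans (distribˡ a 1# x) (+-congʳ (*-identityʳ a))))

      Below : Pred ℝ 0ℓ
      Below y = y * y ≤ x

      sup : ∃[ s ] IsSupremum Below s
      sup = completeness Below
        (0# , ≤-trans (inj₂ (zeroˡ 0#)) 0≤x)
        (a , λ y²≤x → inj₁ (square-cancel-< (inj₁ 0<a) (≤-<-trans y²≤x x<a²)))

  √_ : ℝ → ℝ
  √ x with 0# ≤? x
  ... | yes 0≤x = proj₁ (Root.sup 0≤x)
  ... | no  _   = 0#

  private
    module RootCorrect {x : ℝ} (0≤x : 0# ≤ x) where
      open Root 0≤x

      s : ℝ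
      s = proj₁ sup

      0≤s : 0# ≤ s
      0≤s = proj₁ (proj₂ sup) (≤-trans (inj₂ (zeroˡ 0#)) 0≤x)

      d : ℝ
      d = a + s

      0<d : 0# < d
      0<d = +-pos 0<a 0≤s

      n t : ℝ
      n = a * s + x
      t = n * d ⁻¹

      td≈n : t * d ≈ n
      td≈n = trans (*-assoc n _ d) (trans (*-congˡ (trans (*-comm _ d)
               (⁻¹-inverseʳ (λ d≈0 → irrefl (sym d≈0) 0<d)))) (*-identityʳ n))

      0≤n : 0# ≤ n
      0≤n = +-nonneg (*-nonneg (inj₁ 0<a) 0≤s) 0≤x

      0≤t : 0# ≤ t
      0≤t = ≮⇒≥ λ t<0 → <⇒≱ (<-respʳ-≈ (zeroʳ d)
              (<-respˡ-≈ (trans (*-comm d t) td≈n) (*-monoʳ-< 0<d t<0))) 0≤n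

      n²-identity : n * n + (x * (s * s) + (a * a) * x) ≈
                    x * (d * d) + (x * x + (a * a) * (s * s))
      n²-identity = solve 3 (λ a s x →
        (a :* s :+ x) :* (a :* s :+ x) :+ (x :* (s :* s) :+ (a :* a) :* x) :=
        x :* ((a :+ s) :* (a :+ s)) :+ (x :* x :+ (a :* a) :* (s :* s))) refl a s x

      t²d²≈n² : (t * t) * (d * d) ≈ n * n
      t²d²≈n² = trans (solve 2 (λ t d → (t :* t) :* (d :* d) := (t :* d) :* (t :* d)) refl t d)
                  (*-cong td≈n td≈n)

      +-cross-< : ∀ {p q u v} → p + u ≈ q + v → v < u → p < q
      +-cross-< {p} {q} {u} {v} eq v<u = +-cancelˡ-< u
        (<-respˡ-≈ (trans (sym eq) (+-comm p u)) (<-respʳ-≈ (+-comm q u) (+-monoʳ-< q v<u)))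

      s²≮x : ¬ (s * s < x)
      s²≮x s²<x = <⇒≱ s<t (proj₁ (proj₂ sup) (inj₁ t²<x))
        where
        t²<x : t * t < x
        t²<x = *-cancelʳ-< (*-pos 0<d 0<d) (<-respˡ-≈ (sym t²d²≈n²)
          (+-cross-< n²-identity (rearrange-< x<a² s²<x)))

        s<t : s < t
        s<t = *-cancelʳ-< 0<d (<-respʳ-≈ (sym td≈n)
          (<-respˡ-≈ (solve 2 (λ a s → a :* s :+ s :* s := s :* (a :+ s)) refl a s)
            (+-monoʳ-< (a * s) s²<x)))

      x≮s² : ¬ (x < s * s)
      x≮s² x<s² = <⇒≱ t<s (proj₂ (proj₂ sup) λ {y} y²≤x →
                    inj₁ (square-cancel-< 0≤t (≤-<-trans y²≤x x<t²)))
        where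
        x<t² : x < t * t
        x<t² = *-cancelʳ-< (*-pos 0<d 0<d) (<-respʳ-≈ (sym t²d²≈n²)
          (+-cross-< (sym n²-identity) (rearrange-< x<a² x<s²)))

        t<s : t < s
        t<s = *-cancelʳ-< 0<d (<-respˡ-≈ (sym td≈n)
          (<-respʳ-≈ (solve 2 (λ a s → a :* s :+ s :* s := s :* (a :+ s)) refl a s)
            (+-monoʳ-< (a * s) x<s²)))

      s²≈x : s * s ≈ x
      s²≈x = ≤-antisym (≮⇒≥ x≮s²) (≮⇒≥ s²≮x)

  √-correct : ∀ {x} → 0# ≤ x → 0# ≤ √ x × (√ x) * (√ x) ≈ x
  √-correct {x} 0≤x with 0# ≤? x
  ... | yes 0≤x′ = RootCorrect.0≤s 0≤x′ , RootCorrect.s²≈x 0≤x′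
  ... | no  0≰x  = ⊥-elim (0≰x 0≤x)

  -- ⌊ x ⌋ is the floor for 0# ≤ x and 0 for negative x.

  private
    floorBelow : ℝ → ℕ → ℕ
    floorBelow x zero    = zero
    floorBelow x (suc n) with fromℕ (suc n) ≤? x
    ... | yes _ = suc n
    ... | no  _ = floorBelow x n

  ⌊_⌋ : ℝ → ℕ
  ⌊ x ⌋ = floorBelow x (proj₁ (archimedean x))

  private
    floorBelow-correct : ∀ {x} → 0# ≤ x → ∀ n → x < fromℕ (suc n) →
                         fromℕ (floorBelow x n) ≤ x × x < fromℕ (suc (floorBelow x n))
    floorBelow-correct 0≤x zero x<1 = 0≤x , x<1
    floorBelow-correct {x} 0≤x (suc n) x<n+2 with fromℕ (suc n) ≤? x
    ... | yes n+1≤x = n+1≤x , x<n+2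
    ... | no  n+1≰x = floorBelow-correct 0≤x n (≰⇒> n+1≰x)

  ⌊⌋-correct : ∀ {x} → 0# ≤ x → fromℕ ⌊ x ⌋ ≤ x × x < fromℕ (suc ⌊ x ⌋)
  ⌊⌋-correct {x} 0≤x =
    let n , x<n = archimedean x
    in floorBelow-correct 0≤x n (<-trans x<n (x<x+d 0<1 (+-comm 1# (fromℕ n))))

  φ : ℝ
  φ = (1# + √ fromℕ 5) * (fromℕ 2) ⁻¹

data ℕ∞ : Set where
  fin : ℕ → ℕ∞
  ∞   : ℕ∞

_≤∞_ : ℕ → ℕ∞ → Set
n ≤∞ fin m = n ℕ.≤ m
n ≤∞ ∞     = ⊤

module ExponentialLattice (𝓡 : RealField) where
  open RealField 𝓡 public hiding (zero)
  open RealFieldProperties 𝓡 public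

  Point : Set
  Point = ℝ × ℝ

  infix 4 _≋_
  _≋_ : Rel Point 0ℓ
  (x , y) ≋ (x′ , y′) = x ≈ x′ × y ≈ y′

  conv : Pred Point 0ℓ → Pred Point 0ℓ
  conv A p =
    Σ[ k ∈ ℕ ] Σ[ q ∈ Vector Point k ] Σ[ w ∈ Vector ℝ k ]
      (∀ i → q i ∈ A) ×
      (∀ i → 0# ≤ w i) ×
      sum w ≈ 1# ×
      p ≋ (sum (λ i → w i * proj₁ (q i)) , sum (λ i → w i * proj₂ (q i)))

  -- A convex m-gon is given by its vertices: m ≥ 3 points, none of which lies in
  -- the convex hull of the others (so they are distinct, no three are collinear
  -- and they are exactly the vertices of their hull).  The order in which they
  -- are listed is immaterial.
  IsConvexPolygon : ∀ {m} → Vector Point m → Set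
  IsConvexPolygon {m} v =
    3 ℕ.≤ m × (∀ i → ¬ conv (λ p → ∃[ j ] (j ≢ i × p ≋ v j)) (v i))

  region : ∀ {m} → Vector Point m → Pred Point 0ℓ
  region v = conv (λ p → ∃[ i ] p ≋ v i)

  record IsEmptyPolygon (S : Pred Point 0ℓ) {m} (v : Vector Point m) : Set where
    field
      isConvexPolygon : IsConvexPolygon v
      vertices∈S      : ∀ i → v i ∈ S
      empty           : ∀ {p} → p ∈ S → p ∈ region v → ∃[ i ] p ≋ v i

  HasEmptyPolygon : Pred Point 0ℓ → ℕ → Set
  HasEmptyPolygon S m = ∃[ v ] IsEmptyPolygon S {m} v

  -- h S is a maximum in ℕ ∪ {∞}, which is not computable from S; it is therefore
  -- given by its graph, and h[ S ]≥ n says that the maximum is at least n.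
  -- h[]≥⇔ shows that the two agree.

  IsHoleNumber : Pred Point 0ℓ → ℕ∞ → Set
  IsHoleNumber S (fin m) = HasEmptyPolygon S m × (∀ {k} → HasEmptyPolygon S k → k ℕ.≤ m)
  IsHoleNumber S ∞       = ∀ n → ∃[ m ] (n ℕ.≤ m × HasEmptyPolygon S m)

  h[_]≥_ : Pred Point 0ℓ → ℕ → Set
  h[ S ]≥ n = ∃[ m ] (n ℕ.≤ m × HasEmptyPolygon S m)

  h[]≥⇔ : ∀ {S x} → IsHoleNumber S x → ∀ n → h[ S ]≥ n ⇔ n ≤∞ x
  h[]≥⇔ {x = fin m} (has , max) n =
    mk⇔ (λ (_ , n≤k , hasₖ) → ℕ.≤-trans n≤k (max hasₖ)) (λ n≤m → m , n≤m , has)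
  h[]≥⇔ {x = ∞} unbounded n = mk⇔ (λ _ → tt) (λ _ → unbounded n)

  L : ℝ → Pred Point 0ℓ
  L α p = ∃[ i ] ∃[ j ] p ≋ (α ^ i , α ^ j)

{-# OPTIONS --safe #-}

-- A vertex is certified by an affine function that it alone minimises or
-- maximises; a lattice point is excluded from a polygon by an affine inequality
-- that holds at all vertices but fails at the point.  Writing [i , j] for
-- (αⁱ , αʲ), the polygons are
--
--   * [0,2], [1,2], [1,1], [2,1], [2,0], which is empty for every α > 1;
--   * [0,k], [1,k], [k-2,k-1], [k-1,k-1], [k-1,k-2], [k,1], [k,0] for
--     φ ≤ α < 2 and k large: [k-1,k-1] is a vertex because 2/α > 1, and the edge
--     from [k-2,k-1] to [k-1,k-2] stays below the chord from [0,k] to [k,0]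
--     because α + 1 ≤ α²;
--   * [0,n], [1,n-1], …, [n,0] with n = ⌊√(1/(α-1))⌋ ≥ 2.  These points are in
--     convex position on the hyperbola xy = αⁿ, and the lattice points beyond it
--     satisfy x + y > 1 + αⁿ, while the polygon lies in x + y ≤ 1 + αⁿ.

module Submission where

open import Data.Empty using (⊥-elim)
open import Data.Fin.Base using (Fin; zero; suc; toℕ; fromℕ<)
open import Data.Fin.Patterns using (0F; 1F; 2F; 3F; 4F; 5F; 6F)
open import Data.Fin.Properties using (toℕ<n; toℕ-fromℕ<; toℕ-injective)
open import Data.Nat.Base as ℕ using (ℕ; zero; suc; z≤n; s≤s)
import Data.Nat.Properties as ℕ
open import Data.Product.Base using (_×_; _,_; ∃-syntax; proj₁; proj₂; swap)
open import Data.Sum.Base using (inj₁; inj₂)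
open import Data.Vec.Functional using (Vector; []; _∷_)
open import Function.Base using (_∘_)
open import Relation.Binary.PropositionalEquality.Core as ≡ using (_≡_; _≢_)
open import Relation.Binary.Definitions using (tri<; tri≈; tri>)
open import Relation.Nullary using (¬_; yes; no)
open import Relation.Unary using (Pred; _∈_)
import Algebra.Properties.CommutativeMonoid.Sum as CommutativeMonoidSum
import Algebra.Properties.Semiring.Exp as SemiringExp
import Algebra.Properties.Semiring.Mult as SemiringMult
import Algebra.Properties.Semiring.Sum as SemiringSum
import Algebra.Solver.Ring.NaturalCoefficients.Default as NatSolver
open import Defs

module Holes (𝓡 : RealField) where
  open ExponentialLattice 𝓡
  open NatSolver commutativeSemiring using (solve; _:=_; _:+_; _:*_; con)
  open CommutativeMonoidSum +-commutativeMonoid using (∑-distrib-+; sum-cong-≋)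
  open SemiringSum semiring using (*-distribˡ-sum; *-distribʳ-sum)
  open SemiringExp semiring using (^-homo-*; ^-congʳ)
  open SemiringMult semiring using (×1-homo-*)

  -- Order arithmetic in an ordered field.

  ≤-reflexive : ∀ {x y} → x ≈ y → x ≤ y
  ≤-reflexive = inj₂

  <⇒≤ : ∀ {x y} → x < y → x ≤ y
  <⇒≤ = inj₁

  ≤-resp₂ : ∀ {x y x′ y′} → x ≈ x′ → y ≈ y′ → x ≤ y → x′ ≤ y′
  ≤-resp₂ x≈ y≈ x≤y = ≤-trans (inj₂ (sym x≈)) (≤-trans x≤y (inj₂ y≈))

  <-resp₂ : ∀ {x y x′ y′} → x ≈ x′ → y ≈ y′ → x < y → x′ < y′
  <-resp₂ x≈ y≈ x<y = <-respˡ-≈ x≈ (<-respʳ-≈ y≈ x<y)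

  +-monoʳ-≤ : ∀ z {x y} → x ≤ y → z + x ≤ z + y
  +-monoʳ-≤ z (inj₁ x<y) = inj₁ (+-monoʳ-< z x<y)
  +-monoʳ-≤ z (inj₂ x≈y) = inj₂ (+-congˡ x≈y)

  +-monoˡ-< : ∀ z {x y} → x < y → x + z < y + z
  +-monoˡ-< z x<y = <-resp₂ (+-comm z _) (+-comm z _) (+-monoʳ-< z x<y)

  +-monoˡ-≤ : ∀ z {x y} → x ≤ y → x + z ≤ y + z
  +-monoˡ-≤ z x≤y = ≤-resp₂ (+-comm z _) (+-comm z _) (+-monoʳ-≤ z x≤y)

  +-mono-≤ : ∀ {x y u v} → x ≤ y → u ≤ v → x + u ≤ y + v
  +-mono-≤ {y = y} {u} x≤y u≤v = ≤-trans (+-monoˡ-≤ u x≤y) (+-monoʳ-≤ y u≤v)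

  +-mono-<-≤ : ∀ {x y u v} → x < y → u ≤ v → x + u < y + v
  +-mono-<-≤ {y = y} {u} x<y u≤v = <-≤-trans (+-monoˡ-< u x<y) (+-monoʳ-≤ y u≤v)

  +-mono-≤-< : ∀ {x y u v} → x ≤ y → u < v → x + u < y + v
  +-mono-≤-< {y = y} {u} x≤y u<v = ≤-<-trans (+-monoˡ-≤ u x≤y) (+-monoʳ-< y u<v)

  *-monoʳ-≤ : ∀ {z x y} → 0# ≤ z → x ≤ y → z * x ≤ z * y
  *-monoʳ-≤ (inj₁ 0<z) (inj₁ x<y) = inj₁ (*-monoʳ-< 0<z x<y)
  *-monoʳ-≤ (inj₁ 0<z) (inj₂ x≈y) = inj₂ (*-congˡ x≈y)
  *-monoʳ-≤ (inj₂ 0≈z) _          =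
    inj₂ (trans (*-congʳ (sym 0≈z)) (trans (zeroˡ _) (trans (sym (zeroˡ _)) (*-congʳ 0≈z))))

  -- This is p - q = v - u < 0 with the subtractions moved across, so that the identity can be
  -- proved by a solver for semirings.
  cross-< : ∀ {p q u v} → p + u ≈ q + v → v < u → p < q
  cross-< {p} {q} {u} {v} eq v<u =
    +-cancelˡ-< u (<-resp₂ (trans (sym eq) (+-comm p u)) (+-comm q u) (+-monoʳ-< q v<u))

  *-monoˡ-< : ∀ {z x y} → 0# < z → x < y → x * z < y * z
  *-monoˡ-< 0<z x<y = <-resp₂ (*-comm _ _) (*-comm _ _) (*-monoʳ-< 0<z x<y)

  *-monoˡ-≤ : ∀ {z x y} → 0# ≤ z → x ≤ y → x * z ≤ y * z
  *-monoˡ-≤ 0≤z x≤y = ≤-resp₂ (*-comm _ _) (*-comm _ _) (*-monoʳ-≤ 0≤z x≤y)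

  0≤1 : 0# ≤ 1#
  0≤1 = <⇒≤ 0<1

  x≤x+d : ∀ {x d} → 0# ≤ d → x ≤ x + d
  x≤x+d {x} 0≤d = ≤-resp₂ (+-identityʳ x) refl (+-monoʳ-≤ x 0≤d)

  -- Expands (x - 1)(y - 1) ≥ 0.
  x+y≤1+xy : ∀ {x y} → 1# ≤ x → 1# ≤ y → x + y ≤ 1# + x * y
  x+y≤1+xy {x} {y} (inj₁ 1<x) (inj₁ 1<y) = <⇒≤ (<-resp₂
    (solve 2 (λ x y → con 1 :* y :+ x :* con 1 := x :+ y) refl x y)
    (+-congʳ (*-identityˡ 1#)) (rearrange-< 1<x 1<y))
  x+y≤1+xy {x} {y} (inj₂ 1≈x) _ = ≤-reflexive
    (+-cong (sym 1≈x) (trans (sym (*-identityˡ y)) (*-congʳ 1≈x)))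
  x+y≤1+xy {x} {y} (inj₁ _) (inj₂ 1≈y) = ≤-reflexive (trans (+-comm x y)
    (+-cong (sym 1≈y) (trans (sym (*-identityʳ x)) (*-congˡ 1≈y))))

  0≤fromℕ : ∀ n → 0# ≤ fromℕ n
  0≤fromℕ zero    = ≤-reflexive refl
  0≤fromℕ (suc n) = <⇒≤ (+-pos 0<1 (0≤fromℕ n))

  fromℕ-mono-< : ∀ {m n} → m ℕ.< n → fromℕ m < fromℕ n
  fromℕ-mono-< {zero}  (s≤s {n = n} _) = +-pos 0<1 (0≤fromℕ n)
  fromℕ-mono-< {suc m} (s≤s m<n)       = +-monoʳ-< 1# (fromℕ-mono-< m<n)

  -- Weighted sums, affine functions and convex hulls.

  sum-mono-≤ : ∀ {k} {f g : Vector ℝ k} → (∀ i → f i ≤ g i) → sum f ≤ sum g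
  sum-mono-≤ {zero}  f≤g = ≤-reflexive refl
  sum-mono-≤ {suc k} f≤g = +-mono-≤ (f≤g zero) (sum-mono-≤ (f≤g ∘ suc))

  -- A positive total forces some weight to be positive, and strictness comes from there: either the
  -- first weight is positive, or it vanishes and the tail carries the whole total.
  weighted-sum-mono-< : ∀ {k} {w f g : Vector ℝ k} → (∀ i → 0# ≤ w i) → 0# < sum w →
                        (∀ i → f i < g i) → sum (λ i → w i * f i) < sum (λ i → w i * g i)
  weighted-sum-mono-< {zero} _ 0<0 _ = ⊥-elim (irrefl refl 0<0)
  weighted-sum-mono-< {suc k} {w} 0≤w 0<Σw f<g with 0≤w zero
  ... | inj₁ 0<w₀ = +-mono-<-≤ (*-monoʳ-< 0<w₀ (f<g zero))
                      (sum-mono-≤ (λ i → *-monoʳ-≤ (0≤w (suc i)) (<⇒≤ (f<g (suc i)))))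
  ... | inj₂ 0≈w₀ = +-mono-≤-< (*-monoʳ-≤ (0≤w zero) (<⇒≤ (f<g zero)))
                      (weighted-sum-mono-< (0≤w ∘ suc)
                        (<-respʳ-≈ (trans (+-congʳ (sym 0≈w₀)) (+-identityˡ _)) 0<Σw)
                        (f<g ∘ suc))

  -- Affinity is encoded as compatibility with combinations whose weights sum to 1, the form in
  -- which `conv` presents its points.
  record Affine (F : Point → ℝ) : Set where
    field
      cong     : ∀ {p q} → p ≋ q → F p ≈ F q
      preserve : ∀ {k} (q : Vector Point k) (w : Vector ℝ k) → sum w ≈ 1# →
                 F (sum (λ i → w i * proj₁ (q i)) , sum (λ i → w i * proj₂ (q i))) ≈
                 sum (λ i → w i * F (q i))

  open Affine

  x-affine : Affine proj₁
  x-affine = record { cong = proj₁ ; preserve = λ _ _ _ → refl }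

  y-affine : Affine proj₂
  y-affine = record { cong = proj₂ ; preserve = λ _ _ _ → refl }

  const-affine : ∀ c → Affine (λ _ → c)
  const-affine c = record
    { cong     = λ _ → refl
    ; preserve = λ _ w Σw≈1 →
        trans (sym (*-identityˡ c)) (trans (*-congʳ (sym Σw≈1)) (*-distribʳ-sum c w))
    }

  +-affine : ∀ {F G} → Affine F → Affine G → Affine (λ p → F p + G p)
  +-affine {F} {G} Fₐ Gₐ = record
    { cong     = λ p≋q → +-cong (cong Fₐ p≋q) (cong Gₐ p≋q)
    ; preserve = λ q w Σw≈1 →
        trans (+-cong (preserve Fₐ q w Σw≈1) (preserve Gₐ q w Σw≈1))
          (trans (sym (∑-distrib-+ (λ i → w i * F (q i)) (λ i → w i * G (q i))))
            (sum-cong-≋ (λ i → sym (distribˡ (w i) (F (q i)) (G (q i))))))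
    }

  *-affine : ∀ c {F} → Affine F → Affine (λ p → c * F p)
  *-affine c {F} Fₐ = record
    { cong     = λ p≋q → *-congˡ (cong Fₐ p≋q)
    ; preserve = λ q w Σw≈1 →
        trans (*-congˡ (preserve Fₐ q w Σw≈1))
          (trans (*-distribˡ-sum c (λ i → w i * F (q i)))
            (sum-cong-≋ (λ i →
              solve 3 (λ c w f → c :* (w :* f) := w :* (c :* f)) refl c (w i) (F (q i)))))
    }

  -- The pentagon and the heptagon are symmetric in the diagonal, so a certificate for one vertex,
  -- composed with `swap`, certifies its mirror image.
  ∘swap-affine : ∀ {F} → Affine F → Affine (F ∘ swap)
  ∘swap-affine Fₐ = record
    { cong     = λ (x≈ , y≈) → cong Fₐ (y≈ , x≈)
    ; preserve = λ q → preserve Fₐ (swap ∘ q)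
    }

  -- With an affine function on each side, either side can be taken constant, which covers lower and
  -- upper bounds at once.
  conv-≤ : ∀ (A : Pred Point _) {F G} → Affine F → Affine G →
           (∀ {q} → q ∈ A → F q ≤ G q) → ∀ {p} → p ∈ conv A → F p ≤ G p
  conv-≤ _ Fₐ Gₐ F≤G (k , q , w , q∈A , 0≤w , Σw≈1 , p≋) =
    ≤-resp₂ (trans (sym (preserve Fₐ q w Σw≈1)) (sym (cong Fₐ p≋)))
            (trans (sym (preserve Gₐ q w Σw≈1)) (sym (cong Gₐ p≋)))
      (sum-mono-≤ (λ i → *-monoʳ-≤ (0≤w i) (F≤G (q∈A i))))

  conv-< : ∀ (A : Pred Point _) {F G} → Affine F → Affine G →
           (∀ {q} → q ∈ A → F q < G q) → ∀ {p} → p ∈ conv A → F p < G p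
  conv-< _ Fₐ Gₐ F<G (k , q , w , q∈A , 0≤w , Σw≈1 , p≋) =
    <-resp₂ (trans (sym (preserve Fₐ q w Σw≈1)) (sym (cong Fₐ p≋)))
            (trans (sym (preserve Gₐ q w Σw≈1)) (sym (cong Gₐ p≋)))
      (weighted-sum-mono-< 0≤w (<-respʳ-≈ (sym Σw≈1) 0<1) (λ i → F<G (q∈A i)))

  module _ {m} {v : Vector Point m} {F : Point → ℝ} (Fₐ : Affine F) where

    -- Were `v i` in the hull of the others, the strict bound would pass to the hull and give F (v
    -- i) < F (v i).
    minimiser∉conv : ∀ {i} → (∀ j → j ≢ i → F (v i) < F (v j)) →
                     ¬ conv (λ p → ∃[ j ] (j ≢ i × p ≋ v j)) (v i)
    minimiser∉conv {i} min v∈ = irrefl refl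
      (conv-< (λ p → ∃[ j ] (j ≢ i × p ≋ v j)) (const-affine _) Fₐ
        (λ (j , j≢i , q≋) → <-respʳ-≈ (sym (cong Fₐ q≋)) (min j j≢i)) v∈)

    maximiser∉conv : ∀ {i} → (∀ j → j ≢ i → F (v j) < F (v i)) →
                     ¬ conv (λ p → ∃[ j ] (j ≢ i × p ≋ v j)) (v i)
    maximiser∉conv {i} max v∈ = irrefl refl
      (conv-< (λ p → ∃[ j ] (j ≢ i × p ≋ v j)) Fₐ (const-affine _)
        (λ (j , j≢i , q≋) → <-respˡ-≈ (sym (cong Fₐ q≋)) (max j j≢i)) v∈)

    region-≥ : ∀ {c} → (∀ i → c ≤ F (v i)) → ∀ {p} → p ∈ region v → c ≤ F p
    region-≥ c≤ = conv-≤ (λ p → ∃[ i ] p ≋ v i) (const-affine _) Fₐ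
      (λ (j , q≋) → ≤-trans (c≤ j) (≤-reflexive (sym (cong Fₐ q≋))))

    region-≤ : ∀ {c} → (∀ i → F (v i) ≤ c) → ∀ {p} → p ∈ region v → F p ≤ c
    region-≤ ≤c = conv-≤ (λ p → ∃[ i ] p ≋ v i) Fₐ (const-affine _)
      (λ (j , q≋) → ≤-trans (≤-reflexive (cong Fₐ q≋)) (≤c j))

  -- Powers of α and points of the lattice.

  module Exponential (α : ℝ) (1<α : 1# < α) where

    0<α : 0# < α
    0<α = <-trans 0<1 1<α

    x<αx : ∀ {x} → 0# < x → x < α * x
    x<αx {x} 0<x = <-resp₂ (*-identityʳ x) (*-comm x α) (*-monoʳ-< 0<x 1<α)

    1≤^ : ∀ n → 1# ≤ α ^ n
    1≤^ zero    = ≤-reflexive refl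
    1≤^ (suc n) = <⇒≤ (≤-<-trans (1≤^ n) (x<αx (<-≤-trans 0<1 (1≤^ n))))

    0<^ : ∀ n → 0# < α ^ n
    0<^ n = <-≤-trans 0<1 (1≤^ n)

    ^-monoʳ-≤ : ∀ {m n} → m ℕ.≤ n → α ^ m ≤ α ^ n
    ^-monoʳ-≤ {n = n} z≤n = 1≤^ n
    ^-monoʳ-≤ (s≤s m≤n)   = *-monoʳ-≤ (<⇒≤ 0<α) (^-monoʳ-≤ m≤n)

    ^-monoʳ-< : ∀ {m n} → m ℕ.< n → α ^ m < α ^ n
    ^-monoʳ-< {m} m<n = <-≤-trans (x<αx (0<^ m)) (^-monoʳ-≤ m<n)

    ^-cancelʳ-≤ : ∀ {m n} → α ^ m ≤ α ^ n → m ℕ.≤ n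
    ^-cancelʳ-≤ α^m≤α^n = ℕ.≮⇒≥ λ n<m → <⇒≱ (^-monoʳ-< n<m) α^m≤α^n

    pt : ℕ → ℕ → Point
    pt i j = α ^ i , α ^ j

    pt∈L : ∀ i j → pt i j ∈ L α
    pt∈L i j = i , j , refl , refl

    x+y : Point → ℝ
    x+y (x , y) = x + y

    x+y-affine : Affine x+y
    x+y-affine = +-affine x-affine y-affine

    x+ay : ℝ → Point → ℝ
    x+ay a (x , y) = x + a * y

    x+ay-affine : ∀ a → Affine (x+ay a)
    x+ay-affine a = +-affine x-affine (*-affine a y-affine)

    ax+by : ℝ → ℝ → Point → ℝ
    ax+by a b (x , y) = a * x + b * y

    ax+by-affine : ∀ a b → Affine (ax+by a b)
    ax+by-affine a b = +-affine (*-affine a x-affine) (*-affine b y-affine)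

    +-comm-<ˡ : ∀ {x y z} → x + y < z → y + x < z
    +-comm-<ˡ {x} {y} = <-respˡ-≈ (+-comm x y)

    +-comm-<ʳ : ∀ {x y z} → z < x + y → z < y + x
    +-comm-<ʳ {x} {y} = <-respʳ-≈ (+-comm x y)

    +-comm-≤ˡ : ∀ {x y z} → x + y ≤ z → y + x ≤ z
    +-comm-≤ˡ {x} {y} = ≤-trans (≤-reflexive (+-comm y x))

    +-comm-≤ʳ : ∀ {x y z} → z ≤ x + y → z ≤ y + x
    +-comm-≤ʳ {x} {y} z≤ = ≤-trans z≤ (≤-reflexive (+-comm x y))

    -- The empty pentagon.

    module Pentagon where

      v : Vector Point 5
      v = pt 0 2 ∷ pt 1 2 ∷ pt 1 1 ∷ pt 2 1 ∷ pt 2 0 ∷ []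

      1<α² : α ^ 0 < α ^ 2
      1<α² = ^-monoʳ-< {0} {2} (s≤s z≤n)

      α<α² : α ^ 1 < α ^ 2
      α<α² = ^-monoʳ-< {1} {2} (s≤s (s≤s z≤n))

      1<α¹ : α ^ 0 < α ^ 1
      1<α¹ = ^-monoʳ-< {0} {1} (s≤s z≤n)

      -- This is (α - 1)² > 0, obtained from the rearrangement inequality.
      2α<1+α² : α ^ 1 + α ^ 1 < α ^ 0 + α ^ 2
      2α<1+α² = <-resp₂
        (solve 1 (λ a → con 1 :* a :+ a :* con 1 := a :* con 1 :+ a :* con 1) refl α)
        (solve 1 (λ a → con 1 :* con 1 :+ a :* a := con 1 :+ a :* (a :* con 1)) refl α)
        (rearrange-< 1<α 1<α)

      α+α³ : x+ay α (pt 2 1) < x+ay α (pt 1 2)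
      α+α³ = <-resp₂
        (solve 1 (λ a → a :* (a :+ a) := a :* (a :* con 1) :+ a :* (a :* con 1)) refl α)
        (solve 1 (λ a → a :* (con 1 :+ a :* a) := a :* con 1 :+ a :* (a :* (a :* con 1))) refl α)
        (*-monoʳ-< 0<α (<-resp₂ (+-cong (*-identityʳ α) (*-identityʳ α))
          (+-congˡ (*-congˡ (*-identityʳ α))) 2α<1+α²))

      min-x : ∀ j → j ≢ 0F → α ^ 0 < proj₁ (v j)
      min-x 0F j≢ = ⊥-elim (j≢ ≡.refl)
      min-x 1F _  = 1<α¹
      min-x 2F _  = 1<α¹
      min-x 3F _  = 1<α²
      min-x 4F _  = 1<α²

      min-y : ∀ j → j ≢ 4F → α ^ 0 < proj₂ (v j)
      min-y 4F j≢ = ⊥-elim (j≢ ≡.refl)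
      min-y 3F _  = 1<α¹
      min-y 2F _  = 1<α¹
      min-y 1F _  = 1<α²
      min-y 0F _  = 1<α²

      min-x+y : ∀ j → j ≢ 2F → x+y (pt 1 1) < x+y (v j)
      min-x+y 0F _  = 2α<1+α²
      min-x+y 1F _  = +-monoʳ-< _ α<α²
      min-x+y 2F j≢ = ⊥-elim (j≢ ≡.refl)
      min-x+y 3F _  = +-monoˡ-< _ α<α²
      min-x+y 4F _  = +-comm-<ʳ 2α<1+α²

      max-x+αy : ∀ j → j ≢ 1F → x+ay α (v j) < x+ay α (pt 1 2)
      max-x+αy 0F _  = +-monoˡ-< _ 1<α¹
      max-x+αy 1F j≢ = ⊥-elim (j≢ ≡.refl)
      max-x+αy 2F _  = +-monoʳ-< _ (*-monoʳ-< 0<α α<α²)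
      max-x+αy 3F _  = α+α³
      max-x+αy 4F _  = <-trans (+-monoʳ-< _ (*-monoʳ-< 0<α 1<α¹)) α+α³

      max-αx+y : ∀ j → j ≢ 3F → x+ay α (swap (v j)) < x+ay α (pt 1 2)
      max-αx+y 4F _  = +-monoˡ-< _ 1<α¹
      max-αx+y 3F j≢ = ⊥-elim (j≢ ≡.refl)
      max-αx+y 2F _  = +-monoʳ-< _ (*-monoʳ-< 0<α α<α²)
      max-αx+y 1F _  = α+α³
      max-αx+y 0F _  = <-trans (+-monoʳ-< _ (*-monoʳ-< 0<α 1<α¹)) α+α³

      convex : ∀ i → ¬ conv (λ p → ∃[ j ] (j ≢ i × p ≋ v j)) (v i)
      convex 0F = minimiser∉conv {v = v} x-affine min-x
      convex 1F = maximiser∉conv {v = v} (x+ay-affine α) max-x+αy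
      convex 2F = minimiser∉conv {v = v} x+y-affine min-x+y
      convex 3F = maximiser∉conv {v = v} (∘swap-affine (x+ay-affine α)) max-αx+y
      convex 4F = minimiser∉conv {v = v} y-affine min-y

      v∈L : ∀ i → v i ∈ L α
      v∈L 0F = pt∈L 0 2
      v∈L 1F = pt∈L 1 2
      v∈L 2F = pt∈L 1 1
      v∈L 3F = pt∈L 2 1
      v∈L 4F = pt∈L 2 0

      x≤α² : ∀ i → proj₁ (v i) ≤ α ^ 2
      x≤α² 0F = <⇒≤ 1<α²
      x≤α² 1F = <⇒≤ α<α²
      x≤α² 2F = <⇒≤ α<α²
      x≤α² 3F = ≤-reflexive refl
      x≤α² 4F = ≤-reflexive refl

      y≤α² : ∀ i → proj₂ (v i) ≤ α ^ 2
      y≤α² 4F = <⇒≤ 1<α²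
      y≤α² 3F = <⇒≤ α<α²
      y≤α² 2F = <⇒≤ α<α²
      y≤α² 1F = ≤-reflexive refl
      y≤α² 0F = ≤-reflexive refl

      2α≤x+y : ∀ i → α ^ 1 + α ^ 1 ≤ x+y (v i)
      2α≤x+y 0F = <⇒≤ (min-x+y 0F λ ())
      2α≤x+y 1F = <⇒≤ (min-x+y 1F λ ())
      2α≤x+y 2F = ≤-reflexive refl
      2α≤x+y 3F = <⇒≤ (min-x+y 3F λ ())
      2α≤x+y 4F = <⇒≤ (min-x+y 4F λ ())

      x+y≤α+α² : ∀ i → x+y (v i) ≤ α ^ 1 + α ^ 2
      x+y≤α+α² 0F = <⇒≤ (+-monoˡ-< _ 1<α¹)
      x+y≤α+α² 1F = ≤-reflexive refl
      x+y≤α+α² 2F = <⇒≤ (+-monoʳ-< _ α<α²)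
      x+y≤α+α² 3F = ≤-reflexive (+-comm _ _)
      x+y≤α+α² 4F = +-comm-≤ˡ (x+y≤α+α² 0F)

      -- The exponent bounds leave a 3 × 3 grid with four points that are not vertices: three lie
      -- below the line x + y = 2α, and `pt 2 2` lies above x + y = α + α².
      lattice-point : ∀ i j → i ℕ.≤ 2 → j ℕ.≤ 2 →
                      α ^ 1 + α ^ 1 ≤ x+y (pt i j) → x+y (pt i j) ≤ α ^ 1 + α ^ 2 →
                      ∃[ k ] pt i j ≋ v k
      lattice-point 0 0 _ _ l _ = ⊥-elim (<⇒≱ (<-trans (+-monoʳ-< _ 1<α¹) (+-monoˡ-< _ 1<α¹)) l)
      lattice-point 0 1 _ _ l _ = ⊥-elim (<⇒≱ (+-monoˡ-< _ 1<α¹) l)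
      lattice-point 0 2 _ _ _ _ = 0F , refl , refl
      lattice-point 1 0 _ _ l _ = ⊥-elim (<⇒≱ (+-monoʳ-< _ 1<α¹) l)
      lattice-point 1 1 _ _ _ _ = 2F , refl , refl
      lattice-point 1 2 _ _ _ _ = 1F , refl , refl
      lattice-point 2 0 _ _ _ _ = 4F , refl , refl
      lattice-point 2 1 _ _ _ _ = 3F , refl , refl
      lattice-point 2 2 _ _ _ u = ⊥-elim (<⇒≱ (+-monoˡ-< _ α<α²) u)
      lattice-point (suc (suc (suc _))) _ (s≤s (s≤s ())) _ _ _
      lattice-point _ (suc (suc (suc _))) _ (s≤s (s≤s ())) _ _

      isEmptyPolygon : IsEmptyPolygon (L α) v
      isEmptyPolygon = record
        { isConvexPolygon = s≤s (s≤s (s≤s z≤n)) , convex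
        ; vertices∈S      = v∈L
        ; empty           = λ {p} (i , j , p≋) p∈ →
            let x≈ , y≈ = p≋
                s≈ = cong x+y-affine {p} {pt i j} p≋
                k , x≈′ , y≈′ = lattice-point i j
                  (^-cancelʳ-≤ (≤-resp₂ x≈ refl (region-≤ {v = v} x-affine x≤α² p∈)))
                  (^-cancelʳ-≤ (≤-resp₂ y≈ refl (region-≤ {v = v} y-affine y≤α² p∈)))
                  (≤-resp₂ refl s≈ (region-≥ {v = v} x+y-affine 2α≤x+y p∈))
                  (≤-resp₂ s≈ refl (region-≤ {v = v} x+y-affine x+y≤α+α² p∈))
            in k , trans x≈ x≈′ , trans y≈ y≈′
        }

    pentagon : HasEmptyPolygon (L α) 5
    pentagon = Pentagon.v , Pentagon.isEmptyPolygon

    -- The empty heptagon.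

    module Heptagon (n : ℕ) (golden : α + 1# ≤ α * α)
      (fit : α ^ 1 + α ^ (3 ℕ.+ n) < α ^ (2 ℕ.+ n) + α ^ (2 ℕ.+ n)) where

      -- These are k - 2, k - 1 and k. Starting at 1 + n keeps r positive, so that `pt r s` lies
      -- strictly to the right of x = 1.
      r s k : ℕ
      r = 1 ℕ.+ n
      s = 2 ℕ.+ n
      k = 3 ℕ.+ n

      N : ℝ
      N = α ^ r

      v : Vector Point 7
      v = pt 0 k ∷ pt 1 k ∷ pt r s ∷ pt s s ∷ pt s r ∷ pt k 1 ∷ pt k 0 ∷ []

      0<N : 0# < N
      0<N = 0<^ r

      1<α¹ : α ^ 0 < α ^ 1
      1<α¹ = ^-monoʳ-< {0} {1} (s≤s z≤n)

      1<α^r : α ^ 0 < α ^ r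
      1<α^r = ^-monoʳ-< {0} {r} (s≤s z≤n)

      1<α^s : α ^ 0 < α ^ s
      1<α^s = ^-monoʳ-< {0} {s} (s≤s z≤n)

      1<α^k : α ^ 0 < α ^ k
      1<α^k = ^-monoʳ-< {0} {k} (s≤s z≤n)

      α^r<α^s : α ^ r < α ^ s
      α^r<α^s = ^-monoʳ-< {r} {s} ℕ.≤-refl

      α^s<α^k : α ^ s < α ^ k
      α^s<α^k = ^-monoʳ-< {s} {k} ℕ.≤-refl

      α<α^k : α ^ 1 < α ^ k
      α<α^k = ^-monoʳ-< {1} {k} (s≤s (s≤s z≤n))

      golden-scaled : ∀ {x} → 0# < x → x * (α + 1#) ≤ x * (α * α)
      golden-scaled 0<x = *-monoʳ-≤ (<⇒≤ 0<x) golden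

      -- For G, x + α²y weights y enough because α² + 1 < α³.  For H, the ratio of
      -- the coefficients must lie strictly between 1 and N/(N − 1): when α = φ the
      -- edge from (1 , αᵏ) to (αʳ , αˢ) has slope −N/(N − 1), where N = αʳ.
      G H : Point → ℝ
      G = x+ay (α ^ 2)
      H = ax+by (N + 1#) N

      0<N+1 : 0# < N + 1#
      0<N+1 = +-pos 0<N 0≤1

      -- The right side exceeds the left by (α²N + N)(α² - α - 1) + N + α, whose first term is
      -- nonnegative by `golden`.
      Gss<G1k : G (pt s s) < G (pt 1 k)
      Gss<G1k = cross-<
        (solve 2 (λ a N →
          (a :* N :+ (a :* (a :* con 1)) :* (a :* N)) :+
          ((((a :* a) :* N) :* (a :* a) :+ N :* (a :* a)) :+ (N :+ a)) :=
          (a :* con 1 :+ (a :* (a :* con 1)) :* (a :* (a :* N))) :+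
          (((a :* a) :* N) :* (a :+ con 1) :+ N :* (a :+ con 1))) refl α N)
        (≤-<-trans
          (+-mono-≤ (golden-scaled (*-pos (*-pos 0<α 0<α) 0<N)) (golden-scaled 0<N))
          (x<x+d (+-pos 0<N (<⇒≤ 0<α)) refl))

      -- This is (α² - 1)(αᵏ - α) > 0.
      Gk1<G1k : G (pt k 1) < G (pt 1 k)
      Gk1<G1k = <-resp₂ (+-congʳ (*-identityˡ _)) (+-congʳ (*-identityˡ _))
        (rearrange-< (^-monoʳ-< {0} {2} (s≤s z≤n)) α<α^k)

      -- The right side exceeds the left by N²(α² - α - 1) + 1.
      H-rs<0k : H (pt r s) < H (pt 0 k)
      H-rs<0k = cross-<
        (solve 2 (λ a N →
          ((N :+ con 1) :* N :+ N :* (a :* N)) :+ ((N :* N) :* (a :* a) :+ con 1) :=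
          ((N :+ con 1) :* con 1 :+ N :* (a :* (a :* N))) :+ (N :* N) :* (a :+ con 1))
          refl α N)
        (≤-<-trans (golden-scaled (*-pos 0<N 0<N)) (x<x+d 0<1 refl))

      H-rs<sr : H (pt r s) < H (pt s r)
      H-rs<sr = <-resp₂ (+-comm _ _) (+-comm _ _)
        (rearrange-< (x<x+d 0<1 refl) α^r<α^s)

      -- The right side exceeds the left by (N + 1)N(α² - α - 1) + N + αN.
      H-rs<k0 : H (pt r s) < H (pt k 0)
      H-rs<k0 = cross-<
        (solve 2 (λ a N →
          ((N :+ con 1) :* N :+ N :* (a :* N)) :+
          (((N :+ con 1) :* N) :* (a :* a) :+ (N :+ a :* N)) :=
          ((N :+ con 1) :* (a :* (a :* N)) :+ N :* con 1) :+
          ((N :+ con 1) :* N) :* (a :+ con 1))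
          refl α N)
        (≤-<-trans (golden-scaled (*-pos 0<N+1 0<N))
          (x<x+d (+-pos 0<N (<⇒≤ (0<^ s))) refl))

      min-x : ∀ j → j ≢ 0F → α ^ 0 < proj₁ (v j)
      min-x 0F j≢ = ⊥-elim (j≢ ≡.refl)
      min-x 1F _  = 1<α¹
      min-x 2F _  = 1<α^r
      min-x 3F _  = 1<α^s
      min-x 4F _  = 1<α^s
      min-x 5F _  = 1<α^k
      min-x 6F _  = 1<α^k

      min-y : ∀ j → j ≢ 6F → α ^ 0 < proj₂ (v j)
      min-y 6F j≢ = ⊥-elim (j≢ ≡.refl)
      min-y 5F _  = 1<α¹
      min-y 4F _  = 1<α^r
      min-y 3F _  = 1<α^s
      min-y 2F _  = 1<α^s
      min-y 1F _  = 1<α^k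
      min-y 0F _  = 1<α^k

      max-G : ∀ j → j ≢ 1F → G (v j) < G (pt 1 k)
      max-G 0F _  = +-monoˡ-< _ 1<α¹
      max-G 1F j≢ = ⊥-elim (j≢ ≡.refl)
      max-G 2F _  = <-trans (+-monoˡ-< _ α^r<α^s) Gss<G1k
      max-G 3F _  = Gss<G1k
      max-G 4F _  = <-trans (+-monoʳ-< _ (*-monoʳ-< (0<^ 2) α^r<α^s)) Gss<G1k
      max-G 5F _  = Gk1<G1k
      max-G 6F _  = <-trans (+-monoʳ-< _ (*-monoʳ-< (0<^ 2) 1<α¹)) Gk1<G1k

      -- Reversing the vertex list reflects it in the diagonal, so each case is one of `max-G`.
      max-G∘swap : ∀ j → j ≢ 5F → G (swap (v j)) < G (pt 1 k)
      max-G∘swap 6F _  = max-G 0F λ ()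
      max-G∘swap 5F j≢ = ⊥-elim (j≢ ≡.refl)
      max-G∘swap 4F _  = max-G 2F λ ()
      max-G∘swap 3F _  = max-G 3F λ ()
      max-G∘swap 2F _  = max-G 4F λ ()
      max-G∘swap 1F _  = max-G 5F λ ()
      max-G∘swap 0F _  = max-G 6F λ ()

      min-H : ∀ j → j ≢ 2F → H (pt r s) < H (v j)
      min-H 0F _  = H-rs<0k
      min-H 1F _  = <-trans H-rs<0k (+-monoˡ-< _ (*-monoʳ-< 0<N+1 1<α¹))
      min-H 2F j≢ = ⊥-elim (j≢ ≡.refl)
      min-H 3F _  = +-monoˡ-< _ (*-monoʳ-< 0<N+1 α^r<α^s)
      min-H 4F _  = H-rs<sr
      min-H 5F _  = <-trans H-rs<k0 (+-monoʳ-< _ (*-monoʳ-< 0<N 1<α¹))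
      min-H 6F _  = H-rs<k0

      min-H∘swap : ∀ j → j ≢ 4F → H (pt r s) < H (swap (v j))
      min-H∘swap 6F _  = min-H 0F λ ()
      min-H∘swap 5F _  = min-H 1F λ ()
      min-H∘swap 4F j≢ = ⊥-elim (j≢ ≡.refl)
      min-H∘swap 3F _  = min-H 3F λ ()
      min-H∘swap 2F _  = min-H 4F λ ()
      min-H∘swap 1F _  = min-H 5F λ ()
      min-H∘swap 0F _  = min-H 6F λ ()

      -- The critical competitors are `pt 1 k` and its mirror image, and `fit` is the comparison
      -- with them.
      max-x+y : ∀ j → j ≢ 3F → x+y (v j) < x+y (pt s s)
      max-x+y 0F _  = <-trans (+-monoˡ-< _ 1<α¹) fit
      max-x+y 1F _  = fit
      max-x+y 2F _  = +-monoˡ-< _ α^r<α^s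
      max-x+y 3F j≢ = ⊥-elim (j≢ ≡.refl)
      max-x+y 4F _  = +-monoʳ-< _ α^r<α^s
      max-x+y 5F _  = +-comm-<ˡ fit
      max-x+y 6F _  = <-trans (+-monoʳ-< _ 1<α¹) (+-comm-<ˡ fit)

      convex : ∀ i → ¬ conv (λ p → ∃[ j ] (j ≢ i × p ≋ v j)) (v i)
      convex 0F = minimiser∉conv {v = v} x-affine min-x
      convex 1F = maximiser∉conv {v = v} (x+ay-affine (α ^ 2)) max-G
      convex 2F = minimiser∉conv {v = v} (ax+by-affine (N + 1#) N) min-H
      convex 3F = maximiser∉conv {v = v} x+y-affine max-x+y
      convex 4F = minimiser∉conv {v = v} (∘swap-affine (ax+by-affine (N + 1#) N)) min-H∘swap
      convex 5F = maximiser∉conv {v = v} (∘swap-affine (x+ay-affine (α ^ 2))) max-G∘swap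
      convex 6F = minimiser∉conv {v = v} y-affine min-y

      v∈L : ∀ i → v i ∈ L α
      v∈L 0F = pt∈L 0 k
      v∈L 1F = pt∈L 1 k
      v∈L 2F = pt∈L r s
      v∈L 3F = pt∈L s s
      v∈L 4F = pt∈L s r
      v∈L 5F = pt∈L k 1
      v∈L 6F = pt∈L k 0

      x≤α^k : ∀ i → proj₁ (v i) ≤ α ^ k
      x≤α^k 0F = <⇒≤ 1<α^k
      x≤α^k 1F = <⇒≤ α<α^k
      x≤α^k 2F = <⇒≤ (<-trans α^r<α^s α^s<α^k)
      x≤α^k 3F = <⇒≤ α^s<α^k
      x≤α^k 4F = <⇒≤ α^s<α^k
      x≤α^k 5F = ≤-reflexive refl
      x≤α^k 6F = ≤-reflexive refl

      y≤α^k : ∀ i → proj₂ (v i) ≤ α ^ k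
      y≤α^k 6F = <⇒≤ 1<α^k
      y≤α^k 5F = <⇒≤ α<α^k
      y≤α^k 4F = <⇒≤ (<-trans α^r<α^s α^s<α^k)
      y≤α^k 3F = <⇒≤ α^s<α^k
      y≤α^k 2F = <⇒≤ α^s<α^k
      y≤α^k 1F = ≤-reflexive refl
      y≤α^k 0F = ≤-reflexive refl

      -- Multiplying `golden` by αʳ shows that the chord from `pt 0 k` to `pt k 0` does not cut
      -- below the edge from `pt r s` to `pt s r`.
      α^s+α^r≤1+α^k : α ^ s + α ^ r ≤ α ^ 0 + α ^ k
      α^s+α^r≤1+α^k = ≤-trans
        (≤-resp₂ (solve 2 (λ a N → N :* (a :+ con 1) := a :* N :+ N) refl α N)
                 (solve 2 (λ a N → N :* (a :* a) := a :* (a :* N)) refl α N)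
          (golden-scaled 0<N))
        (<⇒≤ (x<x+d 0<1 (+-comm _ _)))

      x+y≥ : ∀ i → α ^ s + α ^ r ≤ x+y (v i)
      x+y≥ 0F = α^s+α^r≤1+α^k
      x+y≥ 1F = ≤-trans α^s+α^r≤1+α^k (+-monoˡ-≤ _ (<⇒≤ 1<α¹))
      x+y≥ 2F = ≤-reflexive (+-comm _ _)
      x+y≥ 3F = +-monoʳ-≤ _ (<⇒≤ α^r<α^s)
      x+y≥ 4F = ≤-reflexive refl
      x+y≥ 5F = +-comm-≤ʳ (x+y≥ 1F)
      x+y≥ 6F = +-comm-≤ʳ (x+y≥ 0F)

      G≤ : ∀ i → G (v i) ≤ G (pt 1 k)
      G≤ 0F = <⇒≤ (max-G 0F λ ())
      G≤ 1F = ≤-reflexive refl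
      G≤ 2F = <⇒≤ (max-G 2F λ ())
      G≤ 3F = <⇒≤ (max-G 3F λ ())
      G≤ 4F = <⇒≤ (max-G 4F λ ())
      G≤ 5F = <⇒≤ (max-G 5F λ ())
      G≤ 6F = <⇒≤ (max-G 6F λ ())

      G∘swap≤ : ∀ i → G (swap (v i)) ≤ G (pt 1 k)
      G∘swap≤ 0F = G≤ 6F
      G∘swap≤ 1F = G≤ 5F
      G∘swap≤ 2F = G≤ 4F
      G∘swap≤ 3F = G≤ 3F
      G∘swap≤ 4F = G≤ 2F
      G∘swap≤ 5F = G≤ 1F
      G∘swap≤ 6F = G≤ 0F

      -- On the row y = αᵏ, a bound on `G` is a bound on x. Through the mirrored bound the lemma
      -- also serves the column x = αᵏ.
      G-top : ∀ i → G (pt i k) ≤ G (pt 1 k) → i ℕ.≤ 1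
      G-top i u = ℕ.≮⇒≥ λ 1<i → <⇒≱ (+-monoˡ-< _ (^-monoʳ-< 1<i)) u

      -- The line x + y = αˢ + αʳ carries the edge from `pt r s` to `pt s r`; this lemma and the
      -- next exclude the lattice points under it.
      too-low : ∀ {i j} → i ℕ.≤ s → j ℕ.< r → ¬ (α ^ s + α ^ r ≤ α ^ i + α ^ j)
      too-low i≤s j<r = <⇒≱ (+-mono-≤-< (^-monoʳ-≤ i≤s) (^-monoʳ-< j<r))

      too-low-inside : ∀ {i j} → i ℕ.≤ r → j ℕ.≤ r → ¬ (α ^ s + α ^ r ≤ α ^ i + α ^ j)
      too-low-inside i≤r j≤r =
        <⇒≱ (+-mono-<-≤ (≤-<-trans (^-monoʳ-≤ i≤r) α^r<α^s) (^-monoʳ-≤ j≤r))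

      vertex-top : ∀ {i} → i ℕ.≤ 1 → ∃[ l ] pt i k ≋ v l
      vertex-top z≤n       = 0F , refl , refl
      vertex-top (s≤s z≤n) = 1F , refl , refl

      vertex-right : ∀ {j} → j ℕ.≤ 1 → ∃[ l ] pt k j ≋ v l
      vertex-right z≤n       = 6F , refl , refl
      vertex-right (s≤s z≤n) = 5F , refl , refl

      vertex-below-top : ∀ {i} → i ℕ.≤ r → α ^ s + α ^ r ≤ α ^ i + α ^ s →
                         ∃[ l ] pt i s ≋ v l
      vertex-below-top i≤r l with ℕ.m≤n⇒m<n∨m≡n i≤r
      ... | inj₁ i<r    = ⊥-elim (too-low (ℕ.≤-refl {s}) i<r (+-comm-≤ʳ l))
      ... | inj₂ ≡.refl = 2F , refl , refl

      vertex-left-of-right : ∀ {j} → j ℕ.≤ r → α ^ s + α ^ r ≤ α ^ s + α ^ j →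
                             ∃[ l ] pt s j ≋ v l
      vertex-left-of-right j≤r l with ℕ.m≤n⇒m<n∨m≡n j≤r
      ... | inj₁ j<r    = ⊥-elim (too-low (ℕ.≤-refl {s}) j<r l)
      ... | inj₂ ≡.refl = 4F , refl , refl

      vertex-inside : ∀ {i j} → i ℕ.≤ s → j ℕ.≤ s → α ^ s + α ^ r ≤ α ^ i + α ^ j →
                      ∃[ l ] pt i j ≋ v l
      vertex-inside i≤s j≤s l with ℕ.m≤n⇒m<n∨m≡n i≤s | ℕ.m≤n⇒m<n∨m≡n j≤s
      ... | inj₁ (s≤s i≤r) | inj₁ (s≤s j≤r) = ⊥-elim (too-low-inside i≤r j≤r l)
      ... | inj₁ (s≤s i≤r) | inj₂ ≡.refl    = vertex-below-top i≤r l
      ... | inj₂ ≡.refl    | inj₁ (s≤s j≤r) = vertex-left-of-right j≤r l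
      ... | inj₂ ≡.refl    | inj₂ ≡.refl    = 3F , refl , refl

      lattice-point : ∀ i j → i ℕ.≤ k → j ℕ.≤ k → α ^ s + α ^ r ≤ α ^ i + α ^ j →
                      G (pt i j) ≤ G (pt 1 k) → G (pt j i) ≤ G (pt 1 k) →
                      ∃[ l ] pt i j ≋ v l
      lattice-point i j i≤k j≤k l u u′ with ℕ.m≤n⇒m<n∨m≡n i≤k | ℕ.m≤n⇒m<n∨m≡n j≤k
      -- The corner `pt k k` is covered here as well: for it the bound on `G` would force k ≤ 1.
      ... | _              | inj₂ ≡.refl    = vertex-top (G-top i u)
      ... | inj₂ ≡.refl    | inj₁ _         = vertex-right (G-top j u′)
      ... | inj₁ (s≤s i≤s) | inj₁ (s≤s j≤s) = vertex-inside i≤s j≤s l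

      isEmptyPolygon : IsEmptyPolygon (L α) v
      isEmptyPolygon = record
        { isConvexPolygon = s≤s (s≤s (s≤s z≤n)) , convex
        ; vertices∈S      = v∈L
        ; empty           = λ {p} (i , j , p≋) p∈ →
            let x≈ , y≈ = p≋
                Gₐ  = x+ay-affine (α ^ 2)
                Gₐ′ = ∘swap-affine Gₐ
                l , x≈′ , y≈′ = lattice-point i j
                  (^-cancelʳ-≤ (≤-resp₂ x≈ refl (region-≤ {v = v} x-affine x≤α^k p∈)))
                  (^-cancelʳ-≤ (≤-resp₂ y≈ refl (region-≤ {v = v} y-affine y≤α^k p∈)))
                  (≤-resp₂ refl (cong x+y-affine {p} {pt i j} p≋)
                    (region-≥ {v = v} x+y-affine x+y≥ p∈))
                  (≤-resp₂ (cong Gₐ {p} {pt i j} p≋) refl (region-≤ {v = v} Gₐ G≤ p∈))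
                  (≤-resp₂ (cong Gₐ′ {p} {pt i j} p≋) refl (region-≤ {v = v} Gₐ′ G∘swap≤ p∈))
            in l , trans x≈ x≈′ , trans y≈ y≈′
        }

    -- The empty polygon on the hyperbola xy = αⁿ.

    module Hyperbola (n : ℕ) (2≤n : 2 ℕ.≤ n)
      (spread : ∀ {a m} → 1 ℕ.≤ a → a ℕ.+ m ≡ n → 1# + α ^ n < α ^ a + α ^ suc m) where

      v : Vector Point (suc n)
      v l = pt (toℕ l) (n ℕ.∸ toℕ l)

      exponents-sum : ∀ l → toℕ l ℕ.+ (n ℕ.∸ toℕ l) ≡ n
      exponents-sum l = ℕ.m+[n∸m]≡n (ℕ.s≤s⁻¹ (toℕ<n l))

      ^*^≈ : ∀ {a b c d} → a ℕ.+ b ≡ c ℕ.+ d → α ^ a * α ^ b ≈ α ^ c * α ^ d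
      ^*^≈ {a} {b} {c} {d} eq =
        trans (sym (^-homo-* α a b)) (trans (^-congʳ α eq) (^-homo-* α c d))

      -- Its level lines are parallel to the tangent of xy = αⁿ at (αⁱ , αᵐ).
      tangent : ℕ → ℕ → Point → ℝ
      tangent i m = ax+by (α ^ m) (α ^ i)

      tangent-affine : ∀ i m → Affine (tangent i m)
      tangent-affine i m = ax+by-affine (α ^ m) (α ^ i)

      -- Moving along the hyperbola raises one exponent and lowers the other, so rearrangement
      -- applies; the equal products αⁱαᵐ = αˡαᵉ then turn its smaller side into the value at the
      -- point of tangency.
      tangent-< : ∀ i m l e → i ℕ.+ m ≡ l ℕ.+ e → l ≢ i →
                  tangent i m (pt i m) < tangent i m (pt l e)
      tangent-< i m l e eq l≢i with ℕ.<-cmp i l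
      ... | tri≈ _ i≡l _ = ⊥-elim (l≢i (≡.sym i≡l))
      ... | tri< i<l _ _ = <-resp₂
        (trans (+-comm _ _) (+-congˡ (trans (*-comm _ _) (sym (^*^≈ {i} {m} {l} {e} eq)))))
        (trans (+-comm _ _) (+-congˡ (*-comm _ _)))
        (rearrange-< (^-monoʳ-< (ℕ.≰⇒> λ m≤e → ℕ.<⇒≢ (ℕ.+-mono-<-≤ i<l m≤e) eq))
          (^-monoʳ-< i<l))
      ... | tri> _ _ l<i = <-resp₂
        (+-congʳ (trans (sym (^*^≈ {i} {m} {l} {e} eq)) (*-comm _ _)))
        (+-congʳ (*-comm _ _))
        (rearrange-< (^-monoʳ-< l<i)
          (^-monoʳ-< (ℕ.≰⇒> λ e≤m → ℕ.<⇒≢ (ℕ.+-mono-<-≤ l<i e≤m) (≡.sym eq))))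

      tangent-≤ : ∀ i m → i ℕ.+ m ≡ n → ∀ l →
                  tangent i m (pt i m) ≤ tangent i m (v l)
      tangent-≤ i m i+m≡n l with toℕ l ℕ.≟ i
      ... | no  l≢i    = <⇒≤ (tangent-< i m (toℕ l) (n ℕ.∸ toℕ l)
                           (≡.trans i+m≡n (≡.sym (exponents-sum l))) l≢i)
      ... | yes ≡.refl = ≤-reflexive (+-congˡ (*-congˡ (^-congʳ α
                           (ℕ.+-cancelˡ-≡ (toℕ l) m (n ℕ.∸ toℕ l)
                             (≡.trans i+m≡n (≡.sym (exponents-sum l)))))))

      convex : ∀ i → ¬ conv (λ p → ∃[ j ] (j ≢ i × p ≋ v j)) (v i)
      convex i = minimiser∉conv {v = v} (tangent-affine (toℕ i) (n ℕ.∸ toℕ i)) λ j j≢i →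
        tangent-< (toℕ i) (n ℕ.∸ toℕ i) (toℕ j) (n ℕ.∸ toℕ j)
          (≡.trans (exponents-sum i) (≡.sym (exponents-sum j))) (j≢i ∘ toℕ-injective)

      -- Both coordinates are at least 1 and their product is αⁿ.
      x+y≤ : ∀ l → x+y (v l) ≤ 1# + α ^ n
      x+y≤ l = ≤-resp₂ refl
        (+-congˡ (trans (sym (^-homo-* α (toℕ l) (n ℕ.∸ toℕ l))) (^-congʳ α (exponents-sum l))))
        (x+y≤1+xy (1≤^ (toℕ l)) (1≤^ (n ℕ.∸ toℕ l)))

      -- If 1 ≤ a ≤ n, lowering b to n - a + 1 only decreases the sum and reaches the first lattice
      -- point past the hyperbola in that column, which `spread` handles. If a = 0 or a > n, a
      -- single coordinate already exceeds αⁿ.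
      above : ∀ a b → n ℕ.< a ℕ.+ b → 1# + α ^ n < α ^ a + α ^ b
      above zero    b n<b = +-monoʳ-< _ (^-monoʳ-< n<b)
      above (suc a) b n<a+b with ℕ.≤-<-connex (suc a) n
      ... | inj₂ n<a = <-respˡ-≈ (+-comm _ _) (+-mono-<-≤ (^-monoʳ-< n<a) (1≤^ b))
      ... | inj₁ a≤n = <-≤-trans (spread {suc a} {n ℕ.∸ suc a} (s≤s z≤n) (ℕ.m+[n∸m]≡n a≤n))
        (+-monoʳ-≤ _ (^-monoʳ-≤ (ℕ.+-cancelˡ-< (suc a) (n ℕ.∸ suc a) b
          (≡.subst (ℕ._< suc a ℕ.+ b) (≡.sym (ℕ.m+[n∸m]≡n a≤n)) n<a+b))))

      lattice-point : ∀ a b {p} → p ≋ pt a b → p ∈ region v → ∃[ l ] p ≋ v l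
      lattice-point a b {p} p≋@(x≈ , y≈) p∈ with ℕ.<-cmp (a ℕ.+ b) n
      ... | tri> _ _ n<a+b = ⊥-elim (<⇒≱ (above a b n<a+b)
        (≤-resp₂ (cong x+y-affine {p} {pt a b} p≋) refl (region-≤ {v = v} x+y-affine x+y≤ p∈)))
      ... | tri≈ _ a+b≡n _ =
        fromℕ< a<1+n , trans x≈ (^-congʳ α (≡.sym toℕ≡a)) , trans y≈ (^-congʳ α
          (ℕ.+-cancelˡ-≡ a b (n ℕ.∸ toℕ (fromℕ< a<1+n)) (≡.trans a+b≡n
            (≡.trans (≡.sym (exponents-sum (fromℕ< a<1+n))) (≡.cong (ℕ._+ (n ℕ.∸ toℕ (fromℕ< a<1+n))) toℕ≡a)))))
        where
        a<1+n : a ℕ.< suc n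
        a<1+n = s≤s (ℕ.m+n≤o⇒m≤o a (ℕ.≤-reflexive a+b≡n))

        toℕ≡a : toℕ (fromℕ< a<1+n) ≡ a
        toℕ≡a = toℕ-fromℕ< a<1+n
      -- The point is separated from the polygon by the tangent at `pt a m`, the point of the
      -- hyperbola directly above it.
      ... | tri< a+b<n _ _ = ⊥-elim (<⇒≱
        (+-monoʳ-< _ (*-monoʳ-< (0<^ a) (^-monoʳ-< b<m)))
        (≤-resp₂ refl (cong (tangent-affine a m) {p} {pt a b} p≋)
          (region-≥ {v = v} (tangent-affine a m) (tangent-≤ a m a+m≡n) p∈)))
        where
        m : ℕ
        m = n ℕ.∸ a

        a+m≡n : a ℕ.+ m ≡ n
        a+m≡n = ℕ.m+[n∸m]≡n (ℕ.m+n≤o⇒m≤o a (ℕ.<⇒≤ a+b<n))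

        b<m : b ℕ.< m
        b<m = ℕ.+-cancelˡ-< a b m (≡.subst (a ℕ.+ b ℕ.<_) (≡.sym a+m≡n) a+b<n)

      isEmptyPolygon : IsEmptyPolygon (L α) v
      isEmptyPolygon = record
        { isConvexPolygon = s≤s 2≤n , convex
        ; vertices∈S      = λ l → pt∈L (toℕ l) (n ℕ.∸ toℕ l)
        ; empty           = λ (a , b , p≋) → lattice-point a b p≋
        }

    -- Growth estimates for powers of 1 + δ.

    module Growth (δ : ℝ) (0<δ : 0# < δ) (α≈1+δ : α ≈ 1# + δ) where

      -- Bernoulli's inequality with the summand 1 traded for strictness; it makes αⁿ exceed any
      -- prescribed bound.
      bernoulli : ∀ n → fromℕ n * δ < α ^ n
      bernoulli zero    = <-respˡ-≈ (sym (zeroˡ δ)) 0<1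
      bernoulli (suc n) = <-resp₂
        (solve 2 (λ M d → M :* d :+ d :* con 1 := (con 1 :+ M) :* d) refl (fromℕ n) δ)
        (trans (solve 2 (λ d P → P :+ d :* P := (con 1 :+ d) :* P) refl δ (α ^ n))
          (*-congʳ (sym α≈1+δ)))
        (+-mono-<-≤ (bernoulli n) (*-monoʳ-≤ (<⇒≤ 0<δ) (1≤^ n)))

      -- The reciprocal Bernoulli bound αⁿ(1 − nδ) ≤ 1.
      ^-upper : ∀ n → α ^ n ≤ 1# + fromℕ n * (δ * α ^ n)
      ^-upper zero    = x≤x+d (≤-reflexive (sym (zeroˡ _)))
      ^-upper (suc n) = ≤-trans
        (≤-resp₂
          (trans (solve 2 (λ d P → P :+ d :* P := (con 1 :+ d) :* P) refl δ (α ^ n))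
            (*-congʳ (sym α≈1+δ)))
          refl (+-monoˡ-≤ (δ * α ^ n) (^-upper n)))
        (≤-trans
          -- The added slack (n + 1)δ²αⁿ turns δαⁿ into δαⁿ⁺¹ in the bound.
          (x≤x+d (*-nonneg (0≤fromℕ (suc n))
            (*-nonneg (<⇒≤ 0<δ) (*-nonneg (<⇒≤ 0<δ) (<⇒≤ (0<^ n))))))
          (≤-reflexive (trans
            (solve 3 (λ M d P →
              con 1 :+ M :* (d :* P) :+ d :* P :+ (con 1 :+ M) :* (d :* (d :* P)) :=
              con 1 :+ (con 1 :+ M) :* (d :* ((con 1 :+ d) :* P))) refl (fromℕ n) δ (α ^ n))
            (+-congˡ (*-congˡ (*-congˡ (*-congʳ (sym α≈1+δ))))))))

      -- With x = αᵃ - 1 and Y = αᵐ the claim reduces to xY < x + δY. The reciprocal bound for Y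
      -- gives xY ≤ x + (mx)δY, so mx < 1 suffices.
      spread : ∀ {a m} → 1 ℕ.≤ a → fromℕ (suc m) * fromℕ a * δ < 1# →
               1# + α ^ a * α ^ m < α ^ a + α ^ suc m
      spread {a} {m} 1≤a small =
        let x , 0<x , X≈1+x = <⇒∃ (^-monoʳ-< {0} {a} 1≤a)

            -- The reciprocal bound for αᵃ and `small` give (m + 1)αᵃ < (m + 1) + αᵃ, which
            -- rearranges to mx < 1.
            Mx<1 : M * x < 1#
            Mx<1 = +-cancelˡ-< (M + X) (<-resp₂
              (trans (*-congˡ X≈1+x) (trans
                (solve 2 (λ M x → (con 1 :+ M) :* (con 1 :+ x) := (M :+ (con 1 :+ x)) :+ M :* x)
                  refl M x)
                (+-congʳ (+-congˡ (sym X≈1+x)))))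
              (solve 2 (λ M X → (con 1 :+ M) :+ con 1 :* X := (M :+ X) :+ con 1) refl M X)
              (≤-<-trans
                (*-monoʳ-≤ (0≤fromℕ (suc m)) (^-upper a))
                (<-respˡ-≈
                  (solve 4 (λ M A d X →
                    (con 1 :+ M) :+ ((con 1 :+ M) :* A :* d) :* X :=
                    (con 1 :+ M) :* (con 1 :+ A :* (d :* X))) refl M (fromℕ a) δ X)
                  (+-monoʳ-< (1# + M) (*-monoˡ-< (0<^ a) small)))))

            xY<x+δY : x * Y < x + δ * Y
            xY<x+δY = ≤-<-trans (*-monoʳ-≤ (<⇒≤ 0<x) (^-upper m))
              (<-resp₂
                (solve 4 (λ M x d Y →
                  x :+ (M :* x) :* (d :* Y) := x :* (con 1 :+ M :* (d :* Y))) refl M x δ Y)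
                (+-congˡ (*-identityˡ _))
                (+-monoʳ-< x (*-monoˡ-< (*-pos 0<δ (0<^ m)) Mx<1)))
        in <-resp₂
          (trans (solve 2 (λ x Y → (con 1 :+ Y) :+ x :* Y := con 1 :+ (con 1 :+ x) :* Y) refl x Y)
            (+-congˡ (*-congʳ (sym X≈1+x))))
          (trans (solve 3 (λ x d Y →
              (con 1 :+ Y) :+ (x :+ d :* Y) := (con 1 :+ x) :+ (con 1 :+ d) :* Y) refl x δ Y)
            (+-cong (sym X≈1+x) (*-congʳ (sym α≈1+δ))))
          (+-monoʳ-< (1# + Y) xY<x+δY)
        where
        M X Y : ℝ
        M = fromℕ m
        X = α ^ a
        Y = α ^ m

      -- Near 2 the apex (αⁿ⁺² , αⁿ⁺²) of the heptagon is barely outside the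
      -- segment joining its neighbours, so the exponent has to grow with 1/(2 − α).
      heptagon-fit : α < fromℕ 2 →
                     ∃[ n ] α ^ 1 + α ^ (3 ℕ.+ n) < α ^ (2 ℕ.+ n) + α ^ (2 ℕ.+ n)
      heptagon-fit α<2 =
        let ε , 0<ε , 2≈α+ε = <⇒∃ α<2
            0<εδ = *-pos 0<ε 0<δ
            -- With n > 1/(εδ), Bernoulli gives 1 < εδn < εαⁿ.
            n , [εδ]⁻¹<n = archimedean ((ε * δ) ⁻¹)
            P = α ^ n

            1<εP : 1# < ε * P
            1<εP = <-trans
              (<-resp₂ (⁻¹-inverseʳ λ εδ≈0 → irrefl (sym εδ≈0) 0<εδ)
                (solve 3 (λ e d M → (e :* d) :* M := e :* (M :* d)) refl ε δ (fromℕ n))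
                (*-monoʳ-< 0<εδ [εδ]⁻¹<n))
              (*-monoʳ-< 0<ε (bernoulli n))

            -- Since 2 = α + ε, doubling αⁿ⁺² gives αⁿ⁺³ + α²εαⁿ, so this is what remains to be
            -- shown.
            α<α²εP : α ^ 1 < α * (α * (ε * P))
            α<α²εP = *-monoʳ-< 0<α (<-trans 1<εP (x<αx (<-trans 0<1 1<εP)))
        in n , <-resp₂ (+-comm _ _)
          (trans (solve 3 (λ a e P →
              a :* (a :* (a :* P)) :+ a :* (a :* (e :* P)) := (a :+ e) :* (a :* (a :* P)))
              refl α ε P)
            (trans (*-congʳ (sym 2≈α+ε))
              (solve 1 (λ Q → (con 1 :+ (con 1 :+ con 0)) :* Q := Q :+ Q) refl (α ^ (2 ℕ.+ n)))))
          (+-monoʳ-< (α ^ (3 ℕ.+ n)) α<α²εP)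

  -- As a ≥ 1, the factor m + 1 is at most n, and a < n unless m = 0. In that case the product is n,
  -- and n < n² because n ≥ 2.
  complement-product-< : ∀ {n a m} → 2 ℕ.≤ n → 1 ℕ.≤ a → a ℕ.+ m ≡ n →
                         suc m ℕ.* a ℕ.< n ℕ.* n
  complement-product-< {suc n} {suc a} {zero} 2≤n _ eq = ℕ.≤-<-trans
    (ℕ.*-monoʳ-≤ 1 (ℕ.m+n≤o⇒m≤o (suc a) (ℕ.≤-reflexive eq))) (ℕ.*-monoˡ-< (suc n) 2≤n)
  complement-product-< {suc n} {suc a} {suc m} _ _ ≡.refl = ℕ.≤-<-trans
    (ℕ.*-monoˡ-≤ (suc a) (s≤s (ℕ.m≤n+m (suc m) a)))
    (ℕ.*-monoʳ-< (suc n) (s≤s (ℕ.m<m+n a (s≤s z≤n))))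

  -- The golden ratio.

  0<2 : 0# < fromℕ 2
  0<2 = fromℕ-mono-< {0} {2} (s≤s z≤n)

  0≤√5 : 0# ≤ √ fromℕ 5
  0≤√5 = proj₁ (√-correct (0≤fromℕ 5))

  √5²≈5 : √ fromℕ 5 * √ fromℕ 5 ≈ fromℕ 5
  √5²≈5 = proj₂ (√-correct (0≤fromℕ 5))

  φ*2≈1+√5 : φ * fromℕ 2 ≈ 1# + √ fromℕ 5
  φ*2≈1+√5 = trans (*-assoc _ _ _) (trans
    (*-congˡ (trans (*-comm _ _) (⁻¹-inverseʳ λ 2≈0 → irrefl (sym 2≈0) 0<2))) (*-identityʳ _))

  1<φ : 1# < φ
  1<φ = *-cancelʳ-< 0<2 (<-resp₂
    (solve 0 (con 1 :+ con 1 := con 1 :* (con 1 :+ (con 1 :+ con 0))) refl)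
    (sym φ*2≈1+√5)
    (+-monoʳ-< 1# (square-cancel-< 0≤√5 (<-resp₂
      (solve 0 (con 1 :+ con 0 := con 1 :* con 1) refl) (sym √5²≈5)
      (fromℕ-mono-< {1} {5} (s≤s (s≤s z≤n)))))))

  -- For α = 1 + δ, doubling φ ≤ α gives √5 ≤ 1 + 2δ. Squaring gives 1 ≤ δ + δ², which is the claim
  -- in terms of δ.
  φ≤⇒golden : ∀ {α} → φ ≤ α → α + 1# ≤ α * α
  φ≤⇒golden {α} φ≤α =
    let δ , 0<δ , α≈1+δ = <⇒∃ (<-≤-trans 1<φ φ≤α)
        w = 1# + (δ + δ)

        √5≤w : √ fromℕ 5 ≤ w
        √5≤w = ≮⇒≥ λ w<√5 → <⇒≱
          (<-resp₂
            (trans (solve 1 (λ d → con 1 :+ (con 1 :+ (d :+ d)) :=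
                (con 1 :+ d) :* (con 1 :+ (con 1 :+ con 0))) refl δ)
              (*-congʳ (sym α≈1+δ)))
            (sym φ*2≈1+√5) (+-monoʳ-< 1# w<√5))
          (*-monoˡ-≤ (<⇒≤ 0<2) φ≤α)

        √5²≤w² : √ fromℕ 5 * √ fromℕ 5 ≤ w * w
        √5²≤w² = ≤-trans (*-monoʳ-≤ 0≤√5 √5≤w) (*-monoˡ-≤ (≤-trans 0≤√5 √5≤w) √5≤w)

        1≤δ+δ² : 1# ≤ δ + δ * δ
        1≤δ+δ² = ≮⇒≥ λ δ+δ²<1 → <⇒≱
          (<-resp₂
            (solve 1 (λ d →
              con 1 :+ (con 1 :+ (con 1 :+ (con 1 :+ (con 1 :+ con 0)))) :* (d :+ d :* d) :=
              (con 1 :+ (d :+ d)) :* (con 1 :+ (d :+ d))) refl δ)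
            (trans (+-congˡ (*-identityʳ (fromℕ 4))) (sym √5²≈5))
            (+-monoʳ-< 1# (*-monoʳ-< (fromℕ-mono-< {0} {4} (s≤s z≤n)) δ+δ²<1)))
          √5²≤w²
    in ≤-resp₂
      (trans (+-comm _ _) (+-congʳ (sym α≈1+δ)))
      (trans (solve 1 (λ d → (con 1 :+ d) :+ (d :+ d :* d) := (con 1 :+ d) :* (con 1 :+ d)) refl δ)
        (*-cong (sym α≈1+δ) (sym α≈1+δ)))
      (≤-trans (≤-reflexive (+-comm _ _)) (+-monoʳ-≤ (1# + δ) 1≤δ+δ²))

  -- The three lower bounds on the number of vertices.

  h≥5 : ∀ α → 1# < α → h[ L α ]≥ 5
  h≥5 α 1<α = 5 , ℕ.≤-refl , Exponential.pentagon α 1<α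

  h≥7 : ∀ α → φ ≤ α → α < fromℕ 2 → h[ L α ]≥ 7
  h≥7 α φ≤α α<2 =
    let 1<α = <-≤-trans 1<φ φ≤α
        δ , 0<δ , α≈1+δ = <⇒∃ 1<α
        open Exponential α 1<α
        n , fit = Growth.heptagon-fit δ 0<δ α≈1+δ α<2
        open Heptagon n (φ≤⇒golden φ≤α) fit
    in 7 , ℕ.≤-refl , v , isEmptyPolygon

  module LowerBound (α : ℝ) (1<α : 1# < α) where
    open Exponential α 1<α

    δ : ℝ
    δ = α - 1#

    0<δ : 0# < δ
    0<δ = <-resp₂ (-‿inverseʳ 1#) refl (+-monoˡ-< (- 1#) 1<α)

    α≈1+δ : α ≈ 1# + δ
    α≈1+δ = trans (sym (+-identityʳ α)) (trans (+-congˡ (sym (-‿inverseˡ 1#)))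
      (trans (sym (+-assoc α (- 1#) 1#)) (+-comm δ 1#)))

    open Growth δ 0<δ α≈1+δ

    n : ℕ
    n = ⌊ √ (δ ⁻¹) ⌋

    n²δ≤1 : fromℕ n * fromℕ n * δ ≤ 1#
    n²δ≤1 =
      let 0≤δ⁻¹ = <⇒≤ (inverse-pos 0<δ)
          0≤√ , √²≈ = √-correct 0≤δ⁻¹
          n≤√ = proj₁ (⌊⌋-correct 0≤√)
      in ≤-resp₂ refl
        (trans (*-congʳ √²≈) (trans (*-comm _ _) (⁻¹-inverseʳ λ δ≈0 → irrefl (sym δ≈0) 0<δ)))
        (*-monoˡ-≤ (<⇒≤ 0<δ) (≤-trans (*-monoʳ-≤ (0≤fromℕ n) n≤√) (*-monoˡ-≤ 0≤√ n≤√)))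

    -- The strictness that `spread` asks for comes from the integers: (m + 1)a < n², whereas n²δ ≤ 1
    -- may be an equality.
    n-spread : 2 ℕ.≤ n → ∀ {a m} → 1 ℕ.≤ a → a ℕ.+ m ≡ n → 1# + α ^ n < α ^ a + α ^ suc m
    n-spread 2≤n {a} {m} 1≤a a+m≡n = <-respˡ-≈
      (+-congˡ (trans (sym (^-homo-* α a m)) (^-congʳ α a+m≡n)))
      (spread {a} {m} 1≤a (<-≤-trans
        (*-monoˡ-< 0<δ (<-resp₂ (×1-homo-* (suc m) a) (×1-homo-* n n)
          (fromℕ-mono-< (complement-product-< 2≤n 1≤a a+m≡n))))
        n²δ≤1))

    h≥n : h[ L α ]≥ n
    h≥n with ℕ.≤-<-connex n 1
    -- The hyperbola yields n + 1 vertices, which make a polygon only from n = 2 on; below that the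
    -- pentagon has enough vertices.
    ... | inj₁ n≤1 = 5 , ℕ.≤-trans n≤1 (s≤s z≤n) , pentagon
    ... | inj₂ 2≤n = suc n , ℕ.n≤1+n n , v , isEmptyPolygon
      where open Hyperbola n 2≤n (n-spread 2≤n)

theorem3 : (𝓡 : RealField) → let open ExponentialLattice 𝓡 in
    (∀ (α : ℝ) → fromℕ 2 ≤ α → h[ L α ]≥ 5) ×
    (∀ (α : ℝ) → φ ≤ α → α < fromℕ 2 → h[ L α ]≥ 7) ×
    (∀ (α : ℝ) → 1# < α → α < φ → h[ L α ]≥ ⌊ √ ((α - 1#) ⁻¹) ⌋)
theorem3 𝓡 =
    (λ α 2≤α → h≥5 α (<-≤-trans 1<2 2≤α))
  , h≥7
  , (λ α 1<α _ → LowerBound.h≥n α 1<α)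
  where
  open ExponentialLattice 𝓡
  open Holes 𝓡

  1<2 : 1# < fromℕ 2
  1<2 = <-respˡ-≈ (+-identityʳ 1#) (fromℕ-mono-< {1} {2} (s≤s (s≤s z≤n)))
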